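{- Let $M=(X,(\leq_k)_{k=1,\dots,n})$ be a multichain with components $C_k=(X,\leq_k)$, let $L:=\prod_{k=1}^n C_k$, let $\delta:X\to L$ be the diagonal map $\delta(x)=(x,\dots,x)$, let $\Delta(L)$ be the join-subsemilattice of $L$ generated by $\delta(X)$, and let $\hat\Delta(L)$ be $\Delta(L)$ with a new least element added. Then the join-semilattice $K(C(M))$ of compact elements of $C(M)$ is isomorphic to $\hat\Delta(L)$ via a join-preserving map.
   Context: A multichain is a set $X$ with finitely many linear orders $\leq_1,\dots,\leq_n$. $C(M)$ is the closure system on $X$ whose closed sets are the sets $\bigcap_{k=1}^n I_k$ with $I_k$ an initial segment of $(X,\leq_k)$, ordered by inclusion; its compact elements are the closures of finite subsets of $X$. $L$ carries the componentwise order. -}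

module Defs where

import Algebra.Construct.NaturalChoice.Max as Max
import Algebra.Construct.NaturalChoice.MaxOp as MaxOp
import Relation.Binary.Construct.Add.Infimum.Equality as AddEquality
import Relation.Binary.Construct.Add.Infimum.NonStrict as AddNonStrict
import Relation.Binary.Construct.On as On
open import Algebra.Core using (Op₂)
open import Data.Fin.Base using (Fin)
open import Data.List.Base using (List; _++_)
open import Data.List.Membership.Propositional using (_∈_)
open import Data.List.Membership.Propositional.Properties
  using (∈-++⁺ˡ; ∈-++⁺ʳ; ∈-++⁻)
open import Data.Nat.Base using (ℕ)
open import Data.Product.Base using (Σ; Σ-syntax; ∃-syntax; _×_; _,_; proj₁; proj₂)
open import Data.Sum.Base using ([_,_]′)
open import Function.Base using (_on_; id)
open import Level using (Level; suc; _⊔_)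
open import Relation.Binary.Bundles using (TotalOrder)
open import Relation.Binary.Core using (Rel)
open import Relation.Binary.Lattice.Bundles using (JoinSemilattice)
open import Relation.Binary.Lattice.Definitions using (Supremum)
open import Relation.Binary.Morphism.Structures using (IsOrderIsomorphism)
open import Relation.Binary.PropositionalEquality.Core using (_≡_)
open import Relation.Binary.Structures using (IsTotalOrder)
open import Relation.Nullary.Construct.Add.Infimum using (_₋; ⊥₋; [_])
open import Relation.Unary using (Pred; _⊆_; _≐_; ⋂)

module _ {c ℓ₁ ℓ₂} (T : TotalOrder c ℓ₁ ℓ₂) where
  open TotalOrder T using (isPartialOrder)
  open Max T using (maxOperator) renaming (_⊔_ to max)
  open MaxOp maxOperator using (x≤x⊔y; x≤y⊔x; ⊔-lub)

  chain-joinSemilattice : JoinSemilattice c ℓ₁ ℓ₂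
  chain-joinSemilattice = record
    { _∨_               = max
    ; isJoinSemilattice = record
      { isPartialOrder = isPartialOrder
      ; supremum       = λ x y → x≤x⊔y x y , x≤y⊔x x y , λ _ → ⊔-lub
      }
    }

module _ {n : ℕ} {c ℓ₁ ℓ₂} (J : Fin n → JoinSemilattice c ℓ₁ ℓ₂) where
  private module J k = JoinSemilattice (J k)

  ∏ : JoinSemilattice c ℓ₁ ℓ₂
  ∏ = record
    { Carrier           = ∀ k → J.Carrier k
    ; _≈_               = λ u v → ∀ k → J._≈_ k (u k) (v k)
    ; _≤_               = λ u v → ∀ k → J._≤_ k (u k) (v k)
    ; _∨_               = λ u v k → J._∨_ k (u k) (v k)
    ; isJoinSemilattice = record
      { isPartialOrder = record
        { isPreorder = record
          { isEquivalence = record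
            { refl  = λ k → J.Eq.refl k
            ; sym   = λ p k → J.Eq.sym k (p k)
            ; trans = λ p q k → J.Eq.trans k (p k) (q k)
            }
          ; reflexive = λ p k → J.reflexive k (p k)
          ; trans     = λ p q k → J.trans k (p k) (q k)
          }
        ; antisym = λ p q k → J.antisym k (p k) (q k)
        }
      ; supremum = λ u v →
          (λ k → J.x≤x∨y k (u k) (v k)) ,
          (λ k → J.y≤x∨y k (u k) (v k)) ,
          (λ _ p q k → J.∨-least k (p k) (q k))
      }
    }

module _ {c ℓ₁ ℓ₂} (J : JoinSemilattice c ℓ₁ ℓ₂) where
  open JoinSemilattice J

  -- Only binary joins: a join-subsemilattice need not have a least element.
  data Generated {p} (S : Pred Carrier p) : Pred Carrier (c ⊔ ℓ₁ ⊔ p) where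
    gen  : ∀ {x} → S x → Generated S x
    join : ∀ {x y} → Generated S x → Generated S y → Generated S (x ∨ y)
    resp : ∀ {x y} → x ≈ y → Generated S x → Generated S y

  generatedBy : ∀ {p} → Pred Carrier p → JoinSemilattice (c ⊔ ℓ₁ ⊔ p) ℓ₁ ℓ₂
  generatedBy S = record
    { Carrier           = Σ Carrier (Generated S)
    ; _≈_               = _≈_ on proj₁
    ; _≤_               = _≤_ on proj₁
    ; _∨_               = λ (x , gx) (y , gy) → x ∨ y , join gx gy
    ; isJoinSemilattice = record
      { isPartialOrder = On.isPartialOrder proj₁ isPartialOrder
      ; supremum       = λ (x , _) (y , _) →
          x≤x∨y x y , y≤x∨y x y , λ _ → ∨-least
      }
    }

module _ {c ℓ₁ ℓ₂} (J : JoinSemilattice c ℓ₁ ℓ₂) where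
  open JoinSemilattice J
  open AddEquality _≈_ using (_≈₋_)
  open AddNonStrict _≤_ using (_≤₋_; ⊥₋≤_; [_]; ≤₋-isPartialOrder)

  private
    _∨₋_ : Op₂ (Carrier ₋)
    ⊥₋    ∨₋ y     = y
    [ x ] ∨₋ ⊥₋    = [ x ]
    [ x ] ∨₋ [ y ] = [ x ∨ y ]

    ∨₋-supremum : Supremum _≤₋_ _∨₋_
    ∨₋-supremum ⊥₋    ⊥₋    = ⊥₋≤ _ , ⊥₋≤ _ , λ _ _ q → q
    ∨₋-supremum ⊥₋    [ y ] = ⊥₋≤ _ , [ reflexive Eq.refl ] , λ _ _ q → q
    ∨₋-supremum [ x ] ⊥₋    = [ reflexive Eq.refl ] , ⊥₋≤ _ , λ _ p _ → p
    ∨₋-supremum [ x ] [ y ] = [ x≤x∨y x y ] , [ y≤x∨y x y ] ,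
      λ { _ [ p ] [ q ] → [ ∨-least p q ] }

  addLeast : JoinSemilattice c (c ⊔ ℓ₁) (c ⊔ ℓ₂)
  addLeast = record
    { Carrier           = Carrier ₋
    ; _≈_               = _≈₋_
    ; _≤_               = _≤₋_
    ; _∨_               = _∨₋_
    ; isJoinSemilattice = record
      { isPartialOrder = ≤₋-isPartialOrder isPartialOrder
      ; supremum       = ∨₋-supremum
      }
    }

module _ {a₁ a₂ a₃ b₁ b₂ b₃}
         (A : JoinSemilattice a₁ a₂ a₃) (B : JoinSemilattice b₁ b₂ b₃) where
  private
    module A = JoinSemilattice A
    module B = JoinSemilattice B

  record IsJoinPreservingIsomorphism (f : A.Carrier → B.Carrier)
         : Set (a₁ ⊔ a₂ ⊔ a₃ ⊔ b₁ ⊔ b₂ ⊔ b₃) where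
    field
      isOrderIsomorphism : IsOrderIsomorphism A._≈_ B._≈_ A._≤_ B._≤_ f
      ∨-homo             : ∀ x y → f (x A.∨ y) B.≈ f x B.∨ f y

record Multichain (n : ℕ) (ℓ : Level) : Set (suc ℓ) where
  field
    X            : Set ℓ
    Order        : Fin n → Rel X ℓ
    isTotalOrder : ∀ k → IsTotalOrder _≡_ (Order k)

  component : Fin n → TotalOrder ℓ ℓ ℓ
  component k = record { isTotalOrder = isTotalOrder k }

module _ {n : ℕ} {ℓ : Level} (M : Multichain n ℓ) where
  open Multichain M
  private module C k = TotalOrder (component k)

  L : JoinSemilattice ℓ ℓ ℓ
  L = ∏ (λ k → chain-joinSemilattice (component k))

  δ : X → JoinSemilattice.Carrier L
  δ x = λ _ → x

  Δ : JoinSemilattice ℓ ℓ ℓ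
  Δ = generatedBy L (λ u → ∃[ x ] JoinSemilattice._≈_ L u (δ x))

  Δ̂ : JoinSemilattice ℓ ℓ ℓ
  Δ̂ = addLeast Δ

  InitialSegment : Fin n → Pred X ℓ → Set ℓ
  InitialSegment k I = ∀ {x y} → Order k x y → I y → I x

  Closed : Pred X ℓ → Set (suc ℓ)
  Closed A = Σ[ I ∈ (Fin n → Pred X ℓ) ]
    (∀ k → InitialSegment k (I k)) × A ≐ ⋂ (Fin n) I

  record IsClosureOf (S A : Pred X ℓ) : Set (suc ℓ) where
    field
      closed   : Closed A
      contains : S ⊆ A
      least    : ∀ B → Closed B → S ⊆ B → A ⊆ B

  -- Finite subsets are given by lists.  The generating list is a witness only:
  -- elements are compared as subsets of X.
  record CompactElement : Set (suc ℓ) where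
    field
      elements    : Pred X ℓ
      generators  : List X
      isClosureOf : IsClosureOf (_∈ generators) elements

    open IsClosureOf isClosureOf public

  open CompactElement

  cl : Pred X ℓ → Pred X ℓ
  cl S = ⋂ (Fin n) (λ k x → ∃[ y ] S y × Order k x y)

  cl-isClosureOf : ∀ S → IsClosureOf S (cl S)
  cl-isClosureOf S = record
    { closed   = _ , (λ k x≤y (z , Sz , y≤z) → z , Sz , C.trans k x≤y y≤z) , id , id
    ; contains = λ Sx k → _ , Sx , C.refl k
    ; least    = λ B (I , initial , B⊆⋂I , ⋂I⊆B) S⊆B x∈cl → ⋂I⊆B λ k →
        let (y , Sy , x≤y) = x∈cl k in initial k x≤y (B⊆⋂I (S⊆B Sy) k)
    }

  K : JoinSemilattice (suc ℓ) ℓ ℓ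
  K = record
    { Carrier           = CompactElement
    ; _≈_               = λ A B → elements A ≐ elements B
    ; _≤_               = λ A B → elements A ⊆ elements B
    ; _∨_               = _∨_
    ; isJoinSemilattice = record
      { isPartialOrder = record
        { isPreorder = record
          { isEquivalence = record
            { refl  = id , id
            ; sym   = λ (p , q) → q , p
            ; trans = λ (p , q) (p′ , q′) → (λ x → p′ (p x)) , (λ x → q (q′ x))
            }
          ; reflexive = proj₁
          ; trans     = λ p q x → q (p x)
          }
        ; antisym = _,_
        }
      ; supremum = λ A B →
          least A _ (closed (A ∨ B)) (λ x∈ → contains (A ∨ B) (∈-++⁺ˡ x∈)) ,
          least B _ (closed (A ∨ B))
            (λ x∈ → contains (A ∨ B) (∈-++⁺ʳ (generators A) x∈)) ,
          λ D A⊆D B⊆D → least (A ∨ B) _ (closed D) λ x∈ →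
            [ (λ x∈A → A⊆D (contains A x∈A)) , (λ x∈B → B⊆D (contains B x∈B)) ]′
              (∈-++⁻ (generators A) x∈)
      }
    }
    where
    _∨_ : Op₂ CompactElement
    A ∨ B = record
      { elements    = cl (_∈ (generators A ++ generators B))
      ; generators  = generators A ++ generators B
      ; isClosureOf = cl-isClosureOf _
      }

{-# OPTIONS --safe #-}

-- Send the closure of a finite set S to the join of the δ(x), x ∈ S, formed in Δ̂(L), so
-- that the closure of ∅ (which is empty because n ≠ 0) goes to the new least element.
-- In a chain an element lies below a finite maximum iff it lies below one of the terms;
-- applied in every component, this says that x belongs to the closure of S iff
-- δ(x) ≤ ⋁ δ(S). Hence the map preserves and reflects order.

module Submission where

open import Defs
open import Data.Nat.Base using (ℕ; NonZero)
open import Data.Product.Base using (∃-syntax)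
open import Level using (Level)

import Algebra.Construct.NaturalChoice.Max as Max
import Algebra.Construct.NaturalChoice.MaxOp as MaxOp
import Relation.Binary.Lattice.Properties.JoinSemilattice as JoinProperties
open import Data.Empty.Polymorphic using (⊥)
open import Data.Fin.Base using (Fin; fromℕ<)
open import Data.List.Base using (List; []; _∷_; _++_; foldr)
open import Data.List.Membership.Propositional using (_∈_; find)
open import Data.List.Relation.Unary.Any using (Any; here; there)
open import Data.Nat.Base using (>-nonZero⁻¹)
open import Data.Product.Base using (_,_)
open import Data.Sum.Base using (_⊎_; inj₁; inj₂)
open import Relation.Binary.Bundles using (TotalOrder)
open import Relation.Binary.Construct.Add.Infimum.Equality using ([_])
open import Relation.Binary.Construct.Add.Infimum.NonStrict using (⊥₋≤_; [_])
open import Relation.Binary.Lattice.Bundles using (JoinSemilattice)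
open import Relation.Binary.PropositionalEquality.Core using (refl)
open import Relation.Nullary.Construct.Add.Infimum using (⊥₋; [_])
open import Relation.Unary using (_⊆_)

module _ {c ℓ₁ ℓ₂} (T : TotalOrder c ℓ₁ ℓ₂) where
  open TotalOrder T
  open Max T using (maxOperator) renaming (_⊔_ to max)
  open MaxOp maxOperator using (⊔-sel)

  ≤max⇒≤⊎≤ : ∀ {x} y z → x ≤ max y z → x ≤ y ⊎ x ≤ z
  ≤max⇒≤⊎≤ y z x≤ with ⊔-sel y z
  ... | inj₁ eq = inj₁ (trans x≤ (reflexive eq))
  ... | inj₂ eq = inj₂ (trans x≤ (reflexive eq))

module _ {n : ℕ} {ℓ : Level} (M : Multichain n ℓ) where
  open Multichain M
  open CompactElement
  private
    module C k = TotalOrder (component k)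
    module L = JoinSemilattice (L M)
    module K = JoinSemilattice (K M)
    module Δ̂ = JoinSemilattice (Δ̂ M)
    module Δ̂ₚ = JoinProperties (Δ̂ M)

  δ̂ : X → Δ̂.Carrier
  δ̂ x = [ δ M x , gen (x , L.Eq.refl) ]

  ⋁δ̂ : List X → Δ̂.Carrier
  ⋁δ̂ = foldr (λ x a → δ̂ x Δ̂.∨ a) ⊥₋

  ⋁δ̂-++ : ∀ xs ys → ⋁δ̂ (xs ++ ys) Δ̂.≈ ⋁δ̂ xs Δ̂.∨ ⋁δ̂ ys
  ⋁δ̂-++ []       ys = Δ̂.Eq.refl
  ⋁δ̂-++ (x ∷ xs) ys = Δ̂.Eq.trans
    (Δ̂ₚ.∨-cong (Δ̂.Eq.refl {δ̂ x}) (⋁δ̂-++ xs ys))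
    (Δ̂.Eq.sym (Δ̂ₚ.∨-assoc (δ̂ x) (⋁δ̂ xs) (⋁δ̂ ys)))

  ⋁δ̂-upper : ∀ {x xs} → x ∈ xs → δ̂ x Δ̂.≤ ⋁δ̂ xs
  ⋁δ̂-upper {x} {_ ∷ xs} (here refl) = Δ̂.x≤x∨y (δ̂ x) (⋁δ̂ xs)
  ⋁δ̂-upper {x} {y ∷ xs} (there x∈)  =
    Δ̂.trans (⋁δ̂-upper x∈) (Δ̂.y≤x∨y (δ̂ y) (⋁δ̂ xs))

  ⋁δ̂-least : ∀ xs {a} → (∀ {x} → x ∈ xs → δ̂ x Δ̂.≤ a) → ⋁δ̂ xs Δ̂.≤ a
  ⋁δ̂-least []       _  = ⊥₋≤ _
  ⋁δ̂-least (x ∷ xs) ub = Δ̂.∨-least (ub (here refl)) (⋁δ̂-least xs λ x∈ → ub (there x∈))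

  -- Induction on the derivation `g`: its `gen` leaves are collected in a list, `join` concatenates.
  -- `resp` keeps the list, since equality in `Δ̂ M` ignores derivations.
  ⋁δ̂-onto : ∀ {u} (g : Generated (L M) (λ v → ∃[ x ] v L.≈ δ M x) u) →
             ∃[ xs ] ⋁δ̂ xs Δ̂.≈ [ u , g ]
  ⋁δ̂-onto (gen (x , u≈δx)) = x ∷ [] , [ L.Eq.sym u≈δx ]
  ⋁δ̂-onto (join g h) with ⋁δ̂-onto g | ⋁δ̂-onto h
  ... | xs , p | ys , q = xs ++ ys , Δ̂.Eq.trans (⋁δ̂-++ xs ys) (Δ̂ₚ.∨-cong p q)
  ⋁δ̂-onto (resp u≈v g) with ⋁δ̂-onto g
  ... | xs , p = xs , Δ̂.Eq.trans p [ u≈v ]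

  -- The order of `Δ̂ M` compares all components at once. `Below` isolates component `k`, so that a
  -- finite join can be split there by linearity. Nothing is below `⊥₋`, the join of the empty list.
  Below : Fin n → X → Δ̂.Carrier → Set ℓ
  Below k x ⊥₋          = ⊥
  Below k x [ u , _ ] = Order k x (u k)

  ≤⇒Below : ∀ {x a} → δ̂ x Δ̂.≤ a → ∀ k → Below k x a
  ≤⇒Below [ δx≤u ] = δx≤u

  Below-≤ : ∀ {k x} a b → a Δ̂.≤ b → Below k x a → Below k x b
  Below-≤ {k} [ _ ] [ _ ] [ u≤v ] x≤u = C.trans k x≤u (u≤v k)

  Below-∨ : ∀ {k x} a b → Below k x (a Δ̂.∨ b) → Below k x a ⊎ Below k x b
  Below-∨     ⊥₋        b         x≤ = inj₂ x≤
  Below-∨     [ _ ]     ⊥₋        x≤ = inj₁ x≤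
  Below-∨ {k} [ u , _ ] [ v , _ ] x≤ = ≤max⇒≤⊎≤ (component k) (u k) (v k) x≤

  -- The entry found may vary with `k`; membership in `cl` asks for no more than one witness per
  -- component.
  Below-⋁δ̂ : ∀ {k x} ys → Below k x (⋁δ̂ ys) → Any (Order k x) ys
  Below-⋁δ̂ (y ∷ ys) x≤ with Below-∨ (δ̂ y) (⋁δ̂ ys) x≤
  ... | inj₁ x≤y  = here x≤y
  ... | inj₂ x≤ys = there (Below-⋁δ̂ ys x≤ys)

  ≤⋁δ̂⇒∈cl : ∀ {x} ys → δ̂ x Δ̂.≤ ⋁δ̂ ys → cl M (_∈ ys) x
  ≤⋁δ̂⇒∈cl ys δx≤ k = find (Below-⋁δ̂ ys (≤⇒Below δx≤ k))

  module _ .{{_ : NonZero n}} where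

    Below⇒≤ : ∀ {x} a → (∀ k → Below k x a) → δ̂ x Δ̂.≤ a
    -- Here `n ≠ 0` enters: component `0` exists, and `Below` is empty there. With no components
    -- `below` would be vacuous, while `δ̂ x` is never under `⊥₋`.
    Below⇒≤ ⊥₋    below with () ← below (fromℕ< (>-nonZero⁻¹ n))
    Below⇒≤ [ _ ] below = [ below ]

    ∈cl⇒≤⋁δ̂ : ∀ {x} ys → cl M (_∈ ys) x → δ̂ x Δ̂.≤ ⋁δ̂ ys
    ∈cl⇒≤⋁δ̂ ys x∈cl = Below⇒≤ (⋁δ̂ ys) λ k →
      let (y , y∈ys , x≤y) = x∈cl k
      in Below-≤ (δ̂ y) (⋁δ̂ ys) (⋁δ̂-upper y∈ys) x≤y

  closureOf : List X → CompactElement M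
  closureOf xs = record
    { elements    = cl M (_∈ xs)
    ; generators  = xs
    ; isClosureOf = cl-isClosureOf M _
    }

  -- A `CompactElement` carries any predicate that satisfies the closure property. Two closures of
  -- the same set contain each other by leastness, so the explicit `cl` may replace it.
  elements⊆cl : ∀ (A : K.Carrier) → elements A ⊆ cl M (_∈ generators A)
  elements⊆cl A = least A _ (closed c) (contains c)
    where c = closureOf (generators A)

  cl⊆elements : ∀ (A : K.Carrier) → cl M (_∈ generators A) ⊆ elements A
  cl⊆elements A = least (closureOf (generators A)) _ (closed A) (contains A)

  toΔ̂ : K.Carrier → Δ̂.Carrier
  toΔ̂ A = ⋁δ̂ (generators A)

  -- Since `B` is closed, it suffices by leastness to place each generator of `A` in `B`.
  toΔ̂-cancel : ∀ A B → toΔ̂ A Δ̂.≤ toΔ̂ B → A K.≤ B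
  toΔ̂-cancel A B A≤B = least A _ (closed B) λ x∈A →
    cl⊆elements B (≤⋁δ̂⇒∈cl (generators B) (Δ̂.trans (⋁δ̂-upper x∈A) A≤B))

  module _ .{{_ : NonZero n}} where

    toΔ̂-mono : ∀ A B → A K.≤ B → toΔ̂ A Δ̂.≤ toΔ̂ B
    toΔ̂-mono A B A⊆B = ⋁δ̂-least (generators A) λ x∈A →
      ∈cl⇒≤⋁δ̂ (generators B) (elements⊆cl B (A⊆B (contains A x∈A)))

    -- `toΔ̂` reads the list of generators, which the subset does not determine; monotonicity in
    -- both directions shows that the choice does not matter.
    toΔ̂-cong : ∀ A B → A K.≈ B → toΔ̂ A Δ̂.≈ toΔ̂ B
    toΔ̂-cong A B (A⊆B , B⊆A) =
      Δ̂.antisym (toΔ̂-mono A B A⊆B) (toΔ̂-mono B A B⊆A)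

    toΔ̂-injective : ∀ A B → toΔ̂ A Δ̂.≈ toΔ̂ B → A K.≈ B
    toΔ̂-injective A B eq =
      toΔ̂-cancel A B (Δ̂.reflexive eq) , toΔ̂-cancel B A (Δ̂.reflexive (Δ̂.Eq.sym eq))

    toΔ̂-surjective : ∀ a → ∃[ A ] (∀ {B} → B K.≈ A → toΔ̂ B Δ̂.≈ a)
    toΔ̂-surjective ⊥₋ = closureOf [] , λ {B} → toΔ̂-cong B (closureOf [])
    toΔ̂-surjective [ _ , g ] with ⋁δ̂-onto g
    ... | xs , p = closureOf xs , λ {B} B≈A → Δ̂.Eq.trans (toΔ̂-cong B (closureOf xs) B≈A) p

theorem7p14 : ∀ {n : ℕ} .{{_ : NonZero n}} {ℓ : Level} (M : Multichain n ℓ) →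
    ∃[ f ] IsJoinPreservingIsomorphism (K M) (Δ̂ M) f
theorem7p14 M = toΔ̂ M , record
  { isOrderIsomorphism = record
    { isOrderMonomorphism = record
      { isOrderHomomorphism = record
        { cong = λ {A} {B} → toΔ̂-cong M A B
        ; mono = λ {A} {B} → toΔ̂-mono M A B
        }
      ; injective = λ {A} {B} → toΔ̂-injective M A B
      ; cancel    = λ {A} {B} → toΔ̂-cancel M A B
      }
    ; surjective = toΔ̂-surjective M
    }
  -- Joins in `K M` concatenate the generator lists.
  ; ∨-homo = λ A B →
      ⋁δ̂-++ M (CompactElement.generators A) (CompactElement.generators B)
  }
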